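{- For any integer $k\geq 1$, $$F(z)=(\tau_{\alpha,0}\circ\tau_{\alpha,1}\circ\cdots\circ\tau_{\alpha,k-1})(F_{k}(z)).$$ As a result, $F(z)$ has the formal matrix continued fraction expansion (understood as the compositions of the transformations $\tau_{\alpha,k}$ in the identities $F(z)=(\tau_{\alpha,0}\circ\tau_{\alpha,1}\circ\cdots\circ\tau_{\alpha,k-1})(F_{k}(z))$, $k\geq 1$) $$F(z)=\cfrac{{\bf 1}}{\alpha_{0}(z)+\alpha^{+}_0\cfrac{{\bf 1}}{\alpha_{1}(z)+\alpha^{+}_1\cfrac{{\bf 1}}{\alpha_{2}(z)+\alpha^{+}_2\cfrac{{\bf 1}}{\alpha_{3}(z)+\ddots}\,\alpha^{ - }_2}\,\alpha^{ - }_1}\,\alpha^{ - }_0}.$$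
   Context: Fix integers $p,q\geq 1$ and, for each $-p\leq k\leq q$, a bi-infinite sequence $(a^{(k)}_{n})_{n\in\mathbb{Z}}$ of complex numbers. Pseudo-quotient. For a $q\times p$ matrix $A=(a_{i,j})_{0\leq i\leq q-1,\,0\leq j\leq p-1}$ over a field with $a_{0,0}\neq 0$, let $T(A)=B=(b_{i,j})$ be the $q\times p$ matrix with $$b_{i,j}=\frac{a_{i+1,j+1}a_{0,0}-a_{0,j+1}a_{i+1,0}}{a_{0,0}}\ (0\leq i\leq q-2,\ 0\leq j\leq p-2),\quad b_{q-1,j}=-\frac{a_{0,j+1}}{a_{0,0}}\ (0\leq j\leq p-2),$$ $$b_{i,p-1}=\frac{a_{i+1,0}}{a_{0,0}}\ (0\leq i\leq q-2),\qquad b_{q-1,p-1}=\frac{1}{a_{0,0}}.$$ $T$ is a bijection from matrices with $a_{0,0}\neq 0$ onto matrices with $b_{q-1,p-1}\neq 0$; write $A=\frac{\mathbf 1}{B}$ if $B=T(A)$. Here the field is $\mathbb{C}((z^{ -1}))$, the field of formal series $\sum_{n\in\mathbb{Z}}a_nz^n$ with complex coefficients and only finitely many nonzero $a_n$ with $n>0$. Coefficients. For $k\geq 0$: $\alpha_k^+$ is the $q\times q$ matrix equal to the identity except that its last row is $(-a_k^{(1)},-a_k^{(2)},\ldots,-a_k^{(q)})$; $\alpha_k^-$ is the $p\times p$ matrix equal to the identity except that its last column is $(a_k^{(-1)},a_k^{(-2)},\ldots,a_k^{(-p)})^{t}$; $\alpha_k(z)$ is the $q\times p$ matrix whose only nonzero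 entry is $z-a_k^{(0)}$ in the bottom right corner. For $q\times p$ matrices $X$, $$\tau_{\alpha,k}(X)=\frac{\mathbf 1}{\alpha_k(z)+\alpha_k^+X\alpha_k^- }.$$ Resolvent matrices. For $k\geq 0$ let $H^{[k]}=(h^{[k]}_{i,j})_{i,j\geq 0}$ be the banded matrix with $h^{[k]}_{i,j}=a^{(j-i)}_{k+\min(i,j)}$ if $-p\leq j-i\leq q$ and $0$ otherwise; so $H=H^{[0]}$ and $H^{[k]}$ is $H$ with its first $k$ rows and columns removed. Put $\phi^{(k)}_{i,j}(z)=\sum_{n=0}^{\infty}((H^{[k]})^n)_{i,j}\,z^{ -n-1}$, and $\phi_{i,j}=\phi^{(0)}_{i,j}$. Define the $q\times p$ matrices $$F(z)=(\phi_{i,j}(z))_{0\leq i\leq q-1,\,0\leq j\leq p-1},\qquad F_k(z)=(\phi^{(k)}_{i,j}(z))_{0\leq i\leq q-1,\,0\leq j\leq p-1}\ (k\geq 1).$$ Equivalently, $\phi_{i,j}(z)=A_{i,j}(z)=\sum_{n\geq 0}A_{[n,i,j]}z^{ -n-1}$, where $A_{[n,i,j]}$ is the sum of the weights of all lattice paths of $n$ steps from $(0,i)$ to $(n,j)$ with no point below the $x$-axis; steps go from $(n,m)$ to $(n+1,m+i)$, $0\leq i\leq q$, with weight $a_m^{(i)}$, or from $(n,m)$ to $(n+1,m-j)$, $1\leq j\leq p$, with weight $a_{m-j}^{(-j)}$; the weight of a path is the product of the weights of its steps ($1$ for the path of length zero), and an empty sum is zero. -}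

module Defs where

open import Algebra.Apartness.Bundles using (HeytingCommutativeRing; HeytingField)
open import Algebra.Bundles using (CommutativeRing)
open import Algebra.Bundles.Raw using (RawRing)
import Algebra.Definitions as AlgebraDefinitions
import Algebra.Definitions.RawMonoid as RawMonoidDefinitions
import Algebra.Properties.Ring as RingProperties
open import Data.Bool.Base using (if_then_else_)
open import Data.Fin.Base using (Fin; zero; suc; toℕ)
import Data.Fin.Properties as Fin
open import Data.Fin.Relation.Unary.Top using (view; ‵fromℕ; ‵inject₁)
open import Data.Integer.Base as ℤ using (ℤ; +_; -[1+_])
import Data.Integer.Properties as ℤ
open import Data.Nat.Base as ℕ using (ℕ; zero; suc; _⊓_; _∸_)
import Data.Nat.Properties as ℕ
open import Data.Product.Base using (Σ-syntax; _×_; proj₁)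
open import Level using (Lift; _⊔_)
open import Relation.Binary.Core using (Rel)
open import Relation.Binary.PropositionalEquality.Core using (subst)
open import Relation.Nullary.Decidable.Core using (does; _×-dec_)

module Matrices {c ℓ} (R : RawRing c ℓ) where
  open RawRing R
  open AlgebraDefinitions _≈_ using (Invertible)
  open RawMonoidDefinitions +-rawMonoid using (sum)

  Matrix : ℕ → ℕ → Set c
  Matrix m n = Fin m → Fin n → Carrier

  infix  4 _≈ᴹ_ _≈𝟏/_
  infixl 6 _+ᴹ_
  infixl 7 _*ᴹ_

  _≈ᴹ_ : ∀ {m n} → Rel (Matrix m n) ℓ
  A ≈ᴹ B = ∀ i j → A i j ≈ B i j

  _+ᴹ_ : ∀ {m n} → Matrix m n → Matrix m n → Matrix m n
  (A +ᴹ B) i j = A i j + B i j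

  _*ᴹ_ : ∀ {l m n} → Matrix l m → Matrix m n → Matrix l n
  (A *ᴹ B) i j = sum (λ k → A i k * B k j)

  1ᴹ : ∀ {n} → Matrix n n
  1ᴹ i j = if does (i Fin.≟ j) then 1# else 0#

  -- T A d is the transform T(A), with d standing for 1 / a₀₀.
  T : ∀ {q-1 p-1} → Matrix (suc q-1) (suc p-1) → Carrier → Matrix (suc q-1) (suc p-1)
  T A d i j with view i | view j
  ... | ‵inject₁ i′ | ‵inject₁ j′ =
    (A (suc i′) (suc j′) * A zero zero + - (A zero (suc j′) * A (suc i′) zero)) * d
  ... | ‵fromℕ      | ‵inject₁ j′ = - (A zero (suc j′) * d)
  ... | ‵inject₁ i′ | ‵fromℕ      = A (suc i′) zero * d
  ... | ‵fromℕ      | ‵fromℕ      = d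

  -- A = 𝟏/B, i.e. a₀₀ ≠ 0 and B = T(A).  Over a field "a₀₀ ≠ 0" is read as
  -- invertibility of a₀₀, which supplies the inverse needed to form T(A).
  _≈𝟏/_ : ∀ {q-1 p-1} → Rel (Matrix (suc q-1) (suc p-1)) (c ⊔ ℓ)
  A ≈𝟏/ B = Σ[ a₀₀⁻¹ ∈ Invertible 1# _*_ (A zero zero) ] B ≈ᴹ T A (proj₁ a₀₀⁻¹)

-- The series field K((z⁻¹)).  The coefficients may come from any field K (the
-- complex numbers being the classical case); only ring operations are used.
module LaurentSeries {c ℓ₁ ℓ₂} (K : HeytingField c ℓ₁ ℓ₂) where
  open HeytingField K
    using (_≈_; _+_; _*_; -_; 0#; 1#; refl; trans; +-cong; +-identityˡ; heytingCommutativeRing)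
    renaming (Carrier to ∣K∣)
  open HeytingCommutativeRing heytingCommutativeRing using (commutativeRing)
  open CommutativeRing commutativeRing using (ring; rawRing; -‿cong)
  open RawRing rawRing using (+-rawMonoid)
  open RawMonoidDefinitions +-rawMonoid using (sum)
  open RingProperties ring using (-0#≈0#)

  infix 4 _≈ᴸ_
  infixl 6 _+ᴸ_
  infixl 7 _*ᴸ_
  infix 8 -ᴸ_

  -- Formal series Σ coeff n zⁿ over n ∈ ℤ, with no terms of degree above bound.
  -- The bound is not part of the series: it is ignored by equality.
  record Laurent : Set (c ⊔ ℓ₁) where
    field
      coeff  : ℤ → ∣K∣
      bound  : ℕ
      vanish : ∀ {n} → + bound ℤ.< n → coeff n ≈ 0#
  open Laurent public

  _≈ᴸ_ : Rel Laurent ℓ₁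
  f ≈ᴸ g = ∀ n → coeff f n ≈ coeff g n

  constant : ∣K∣ → Laurent
  constant x .coeff (+ zero)  = x
  constant x .coeff (+ suc _) = 0#
  constant x .coeff -[1+ _ ]  = 0#
  constant x .bound           = 0
  constant x .vanish (ℤ.+<+ (ℕ.s≤s _)) = refl

  z : Laurent
  z .coeff (+ 0)           = 0#
  z .coeff (+ 1)           = 1#
  z .coeff (+ suc (suc _)) = 0#
  z .coeff -[1+ _ ]        = 0#
  z .bound                 = 1
  z .vanish (ℤ.+<+ (ℕ.s≤s (ℕ.s≤s _))) = refl

  _+ᴸ_ : Laurent → Laurent → Laurent
  (f +ᴸ g) .coeff n = coeff f n + coeff g n
  (f +ᴸ g) .bound   = bound f ℕ.⊔ bound g
  (f +ᴸ g) .vanish b<n = trans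
    (+-cong (vanish f (ℤ.≤-<-trans (ℤ.+≤+ (ℕ.m≤m⊔n (bound f) (bound g))) b<n))
            (vanish g (ℤ.≤-<-trans (ℤ.+≤+ (ℕ.m≤n⊔m (bound f) (bound g))) b<n)))
    (+-identityˡ 0#)

  -ᴸ_ : Laurent → Laurent
  (-ᴸ f) .coeff n = - coeff f n
  (-ᴸ f) .bound   = bound f
  (-ᴸ f) .vanish b<n = trans (-‿cong (vanish f b<n)) -0#≈0#

  -- With N, M the bounds of f and g, cauchy f g e is the coefficient of
  -- z ^ (N + M - e) in the product: the sum of f_{N - m} g_{M - (e - m)} over
  -- 0 ≤ m ≤ e, the remaining terms of Σ_{i + j = N + M - e} f_i g_j being zero.
  cauchy : Laurent → Laurent → ℤ → ∣K∣
  cauchy f g (+ e) = sum {suc e} λ m →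
    coeff f (+ bound f ℤ.- + toℕ m) * coeff g (+ bound g ℤ.- + (e ∸ toℕ m))
  cauchy f g -[1+ _ ] = 0#

  _*ᴸ_ : Laurent → Laurent → Laurent
  (f *ᴸ g) .coeff n = cauchy f g (+ (bound f ℕ.+ bound g) ℤ.- n)
  (f *ᴸ g) .bound   = bound f ℕ.+ bound g
  (f *ᴸ g) .vanish {n} b<n = cauchy-negative
      (subst (+ (bound f ℕ.+ bound g) ℤ.- n ℤ.<_) (ℤ.+-inverseʳ n) (ℤ.+-monoˡ-< (ℤ.- n) b<n))
    where
    cauchy-negative : ∀ {e} → e ℤ.< + 0 → cauchy f g e ≈ 0#
    cauchy-negative ℤ.-<+ = refl

  laurentRing : RawRing (c ⊔ ℓ₁) ℓ₁
  laurentRing = record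
    { Carrier = Laurent
    ; _≈_     = _≈ᴸ_
    ; _+_     = _+ᴸ_
    ; _*_     = _*ᴸ_
    ; -_      = -ᴸ_
    ; 0#      = constant 0#
    ; 1#      = constant 1#
    }

-- a k n is a_n^{(k)}.  It is total in k for convenience only: values with k
-- outside [-p, q] are never used.
module ContinuedFraction {c ℓ₁ ℓ₂} (K : HeytingField c ℓ₁ ℓ₂) (p-1 q-1 : ℕ)
                         (a : ℤ → ℤ → HeytingField.Carrier K) where
  open HeytingField K using (_+_; _*_; -_; 0#; 1#; heytingCommutativeRing)
    renaming (Carrier to ∣K∣)
  open HeytingCommutativeRing heytingCommutativeRing using (commutativeRing)
  open CommutativeRing commutativeRing using (rawRing)
  open RawRing rawRing using (+-rawMonoid)
  open RawMonoidDefinitions +-rawMonoid using (sum)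
  open LaurentSeries K public
  open Matrices laurentRing public

  p q : ℕ
  p = suc p-1
  q = suc q-1

  α⁺ : ℕ → Matrix q q
  α⁺ k i j with view i
  ... | ‵fromℕ     = constant (- a (+ suc (toℕ j)) (+ k))
  ... | ‵inject₁ _ = 1ᴹ i j

  α⁻ : ℕ → Matrix p p
  α⁻ k i j with view j
  ... | ‵fromℕ     = constant (a -[1+ toℕ i ] (+ k))
  ... | ‵inject₁ _ = 1ᴹ i j

  α : ℕ → Matrix q p
  α k i j with view i | view j
  ... | ‵fromℕ | ‵fromℕ = z +ᴸ -ᴸ constant (a (+ 0) (+ k))
  ... | _      | _      = constant 0#

  -- Transformations are represented by their graphs, since 𝟏/ is only partially
  -- defined: τ k Y X says that Y = τ_{α,k}(X).
  τ : ℕ → Rel (Matrix q p) (c ⊔ ℓ₁)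
  τ k Y X = Y ≈𝟏/ (α k +ᴹ α⁺ k *ᴹ X *ᴹ α⁻ k)

  -- τ∘ k Y X says that Y = (τ_{α,0} ∘ ⋯ ∘ τ_{α,k-1})(X).
  τ∘ : ℕ → Rel (Matrix q p) (c ⊔ ℓ₁)
  τ∘ zero    Y X = Lift (c ⊔ ℓ₁) (Y ≈ᴹ X)
  τ∘ (suc k) Y X = Σ[ Z ∈ Matrix q p ] τ∘ k Y Z × τ k Z X

  -- The entry h_{i,j} of the banded matrix H^{[k]}.
  H : ℕ → ℕ → ℕ → ∣K∣
  H k i j =
    if does ((ℤ.- + p ℤ.≤? j-i) ×-dec (j-i ℤ.≤? + q))
    then a j-i (+ (k ℕ.+ (i ⊓ j)))
    else 0#
    where
    j-i : ℤ
    j-i = + j ℤ.- + i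

  -- The entry (i , j) of (H^{[k]})ⁿ.  Row i of H^{[k]} vanishes beyond column
  -- i + q, so the matrix product is the finite sum over columns l ≤ i + q.
  H^ : ℕ → ℕ → ℕ → ℕ → ∣K∣
  H^ k zero    i j = if does (i ℕ.≟ j) then 1# else 0#
  H^ k (suc n) i j = sum {suc (i ℕ.+ q)} λ l → H k i (toℕ l) * H^ k n (toℕ l) j

  φ : ℕ → ℕ → ℕ → Laurent
  φ k i j .coeff (+ _)    = 0#
  φ k i j .coeff -[1+ n ] = H^ k n i j
  φ k i j .bound          = 0
  φ k i j .vanish (ℤ.+<+ _) = HeytingField.refl K

  F[_] : ℕ → Matrix q p
  F[ k ] i j = φ k (toℕ i) (toℕ j)

  F : Matrix q p
  F = F[ 0 ]

{-# OPTIONS --safe #-}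
module Submission where

-- H^[k] is H^[k+1] bordered by a first row (h₀₀ , r) and a first column (h₀₀ , s).
-- Let φ and φ′ be the resolvents of H^[k] and H^[k+1], and put S = φ′ s.  By
-- z φ = 1 + H^[k] φ, the columns φ_{i+1,j} and φ′_{i,j-1} + S_i φ_{0,j} (with
-- φ′_{i,-1} = 0) solve the same linear system over H^[k+1].  Such a system has
-- only one solution of bounded degree, since it expresses each coefficient by
-- coefficients of higher degree; hence the two columns agree.  Row 0 of
-- z φ = 1 + H^[k] φ then yields D φ_{0,0} = 1 and D φ_{0,j+1} = (r φ′)_j for
-- the Schur complement D = z - h₀₀ - r S, from which T(F_k) can be read off.

open import Defs
open import Algebra.Apartness.Bundles using (HeytingCommutativeRing; HeytingField)
open import Algebra.Bundles using (CommutativeRing)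
open import Algebra.Bundles.Raw using (RawRing)
import Algebra.Properties.CommutativeSemigroup as CommutativeSemigroupProperties
import Algebra.Properties.Ring as RingProperties
import Algebra.Properties.Semiring.Sum as SemiringSum
open import Data.Bool.Base using (if_then_else_; true; false)
open import Data.Fin.Base using (Fin; zero; suc; toℕ; fromℕ; inject₁)
open import Data.Fin.Properties using (toℕ-inject₁; toℕ<n; toℕ≤pred[n])
open import Data.Fin.Relation.Unary.Top using (view; view-fromℕ; view-inject₁; ‵fromℕ; ‵inject₁)
open import Data.Integer.Base as ℤ using (ℤ; +_; -[1+_])
import Data.Integer.Properties as ℤ
open import Data.Nat.Base as ℕ using (ℕ; zero; suc; _≤_; _∸_)
import Data.Nat.Properties as ℕ
open import Data.Product.Base using (_,_; _×_; proj₁; proj₂)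
open import Function.Base using (_∘_)
open import Level using (_⊔_; lift)
import Relation.Binary.PropositionalEquality as ≡
open ≡ using (_≡_)
import Relation.Binary.Reasoning.Setoid as SetoidReasoning
open import Relation.Nullary.Decidable using (yes; no; does; _×-dec_; dec-true; dec-false)

-- Cauchy product of power series.

module PowerSeries {c ℓ} (R : CommutativeRing c ℓ) where
  open CommutativeRing R hiding (zero)
  open SemiringSum semiring
  open SetoidReasoning setoid

  Series : Set c
  Series = ℕ → Carrier

  infix  4 _≈ˢ_
  infixl 7 _⊛_

  _≈ˢ_ : Series → Series → Set ℓ
  f ≈ˢ g = ∀ e → f e ≈ g e

  -- The sum has the shape of `cauchy`, so multiplying Laurent series amounts to applying `⊛` to
  -- their expansions.
  _⊛_ : Series → Series → Series
  (f ⊛ g) e = sum {suc e} λ m → f (toℕ m) * g (e ∸ toℕ m)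

  ⊛-cong : ∀ {f f′ g g′} → f ≈ˢ f′ → g ≈ˢ g′ → f ⊛ g ≈ˢ f′ ⊛ g′
  ⊛-cong f≈f′ g≈g′ e =
    sum-cong-≋ {suc e} λ m → *-cong (f≈f′ (toℕ m)) (g≈g′ (e ∸ toℕ m))

  ⊛-congˡ : ∀ f {g g′} → g ≈ˢ g′ → f ⊛ g ≈ˢ f ⊛ g′
  ⊛-congˡ f g≈g′ = ⊛-cong {f = f} (λ _ → refl) g≈g′

  ⊛-congʳ : ∀ g {f f′} → f ≈ˢ f′ → f ⊛ g ≈ˢ f′ ⊛ g
  ⊛-congʳ g f≈f′ = ⊛-cong {g = g} f≈f′ (λ _ → refl)

  ⊛-distribʳ : ∀ f g h → (λ m → f m + g m) ⊛ h ≈ˢ λ e → (f ⊛ h) e + (g ⊛ h) e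
  ⊛-distribʳ f g h e = trans
    (sum-cong-≋ {suc e} λ m → distribʳ (h (e ∸ toℕ m)) (f (toℕ m)) (g (toℕ m)))
    (∑-distrib-+ {suc e} (λ m → f (toℕ m) * h (e ∸ toℕ m)) (λ m → g (toℕ m) * h (e ∸ toℕ m)))

  ⊛-scaleˡ : ∀ x f g → (λ m → x * f m) ⊛ g ≈ˢ λ e → x * (f ⊛ g) e
  ⊛-scaleˡ x f g e = trans
    (sum-cong-≋ {suc e} λ m → *-assoc x (f (toℕ m)) (g (e ∸ toℕ m)))
    (sym (*-distribˡ-sum {suc e} x (λ m → f (toℕ m) * g (e ∸ toℕ m))))

  -- By definition the sum unfolds at its first term; this unfolds it at the last one, which is what
  -- commutativity requires.
  ⊛-sucʳ : ∀ f g e → (f ⊛ g) (suc e) ≈ (f ⊛ (g ∘ suc)) e + f (suc e) * g 0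
  ⊛-sucʳ f g zero    = trans (+-congˡ (+-identityʳ _)) (+-congʳ (sym (+-identityʳ _)))
  ⊛-sucʳ f g (suc e) = trans (+-congˡ (⊛-sucʳ (f ∘ suc) g e)) (sym (+-assoc _ _ _))

  -- Splitting one product at its first term and the other at its last leaves two shorter products,
  -- to which induction applies.
  ⊛-comm : ∀ f g → f ⊛ g ≈ˢ g ⊛ f
  ⊛-comm f g zero    = +-congʳ (*-comm (f 0) (g 0))
  ⊛-comm f g (suc e) = begin
    f 0 * g (suc e) + ((f ∘ suc) ⊛ g) e  ≈⟨ +-cong (*-comm _ _) (⊛-comm (f ∘ suc) g e) ⟩
    g (suc e) * f 0 + (g ⊛ (f ∘ suc)) e  ≈⟨ +-comm _ _ ⟩
    (g ⊛ (f ∘ suc)) e + g (suc e) * f 0  ≈⟨ ⊛-sucʳ g f e ⟨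
    (g ⊛ f) (suc e)                      ∎

  -- The tail of a product is (f ⊛ g) ∘ suc = f 0 · (g ∘ suc) + (f ∘ suc) ⊛ g.
  ⊛-assoc : ∀ f g h → (f ⊛ g) ⊛ h ≈ˢ f ⊛ (g ⊛ h)
  ⊛-assoc f g h zero = +-congʳ (begin
    (f 0 * g 0 + 0#) * h 0    ≈⟨ *-congʳ (+-identityʳ _) ⟩
    f 0 * g 0 * h 0           ≈⟨ *-assoc _ _ _ ⟩
    f 0 * (g 0 * h 0)         ≈⟨ *-congˡ (+-identityʳ _) ⟨
    f 0 * (g 0 * h 0 + 0#)    ∎)
  ⊛-assoc f g h (suc e) = begin
    (f 0 * g 0 + 0#) * h (suc e) + (((f ⊛ g) ∘ suc) ⊛ h) e
      ≈⟨ +-cong (trans (*-congʳ (+-identityʳ _)) (*-assoc _ _ _))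
                (⊛-distribʳ (λ m → f 0 * g (suc m)) ((f ∘ suc) ⊛ g) h e) ⟩
    f 0 * (g 0 * h (suc e)) + (((λ m → f 0 * g (suc m)) ⊛ h) e + (((f ∘ suc) ⊛ g) ⊛ h) e)
      ≈⟨ +-congˡ (+-cong (⊛-scaleˡ (f 0) (g ∘ suc) h e) (⊛-assoc (f ∘ suc) g h e)) ⟩
    f 0 * (g 0 * h (suc e)) + (f 0 * ((g ∘ suc) ⊛ h) e + ((f ∘ suc) ⊛ (g ⊛ h)) e)
      ≈⟨ +-assoc _ _ _ ⟨
    f 0 * (g 0 * h (suc e)) + f 0 * ((g ∘ suc) ⊛ h) e + ((f ∘ suc) ⊛ (g ⊛ h)) e
      ≈⟨ +-congʳ (distribˡ _ _ _) ⟨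
    f 0 * (g ⊛ h) (suc e) + ((f ∘ suc) ⊛ (g ⊛ h)) e  ∎

  monomial : Carrier → Series
  monomial x zero    = x
  monomial x (suc _) = 0#

  ⊛-zeroˡ : ∀ {f} g → f ≈ˢ (λ _ → 0#) → f ⊛ g ≈ˢ λ _ → 0#
  ⊛-zeroˡ g f≈0 e = trans
    (sum-cong-≋ {suc e} λ m → trans (*-congʳ (f≈0 (toℕ m))) (zeroˡ (g (e ∸ toℕ m))))
    (sum-replicate-zero (suc e))

  ⊛-monomialˡ : ∀ x g → monomial x ⊛ g ≈ˢ λ e → x * g e
  ⊛-monomialˡ x g zero    = +-identityʳ _
  ⊛-monomialˡ x g (suc e) = trans (+-congˡ (⊛-zeroˡ g (λ _ → refl) e)) (+-identityʳ _)

+1-+1 : ∀ m n → + suc m ℤ.- + suc n ≡ + m ℤ.- + n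
+1-+1 m n = ≡.trans (ℤ.[1+m]⊖[1+n]≡m⊖n m n) (≡.sym (ℤ.m-n≡m⊖n m n))

i-[i-j]≡j : ∀ i j → i ℤ.- (i ℤ.- j) ≡ j
i-[i-j]≡j i j = begin
  i ℤ.- (i ℤ.- j)             ≡⟨ ≡.cong (λ n → i ℤ.+ n) (ℤ.neg-distrib-+ i (ℤ.- j)) ⟩
  i ℤ.+ (ℤ.- i ℤ.- ℤ.- j)     ≡⟨ ℤ.+-assoc i (ℤ.- i) (ℤ.- ℤ.- j) ⟨
  i ℤ.- i ℤ.- ℤ.- j           ≡⟨ ≡.cong₂ ℤ._+_ (ℤ.+-inverseʳ i) (ℤ.neg-involutive j) ⟩
  + 0 ℤ.+ j                   ≡⟨ ℤ.+-identityˡ j ⟩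
  j                           ∎
  where open ≡.≡-Reasoning

-- Laurent series form a commutative ring.

module LaurentProperties {c ℓ₁ ℓ₂} (K : HeytingField c ℓ₁ ℓ₂) where
  open HeytingCommutativeRing (HeytingField.heytingCommutativeRing K) using (commutativeRing)
  open CommutativeRing commutativeRing renaming (Carrier to ∣K∣)
  open RingProperties ring using (-0#≈0#)
  open LaurentSeries K
  open PowerSeries commutativeRing
  open SetoidReasoning setoid

  -- Coefficients read downwards from degree `N`. The starting degree is a parameter because equal
  -- series may carry different bounds.
  expand : Laurent → ℕ → Series
  expand f N e = coeff f (+ N ℤ.- + e)

  coeff-cong : ∀ f {m n} → m ≡ n → coeff f m ≈ coeff f n
  coeff-cong f m≡n = reflexive (≡.cong (coeff f) m≡n)

  vanish-≤ : ∀ f {N n} → bound f ≤ N → + N ℤ.< n → coeff f n ≈ 0#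
  vanish-≤ f b≤N N<n = vanish f (ℤ.≤-<-trans (ℤ.+≤+ b≤N) N<n)

  -- Above degree `N` both series vanish; any other degree `n` occurs in the expansions at index
  -- `N - n`.
  expand⇒≈ : ∀ f g N → bound f ≤ N → bound g ≤ N → expand f N ≈ˢ expand g N → f ≈ᴸ g
  expand⇒≈ f g N f≤N g≤N eq n with n ℤ.≤? + N
  ... | no  n≰N = trans (vanish-≤ f f≤N N<n) (sym (vanish-≤ g g≤N N<n))
    where
    N<n : + N ℤ.< n
    N<n = ℤ.≰⇒> n≰N
  ... | yes n≤N = ≡.subst (λ m → coeff f m ≈ coeff g m) N-e≡n (eq ℤ.∣ + N ℤ.- n ∣)
    where
    N-e≡n : + N ℤ.- + ℤ.∣ + N ℤ.- n ∣ ≡ n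
    N-e≡n = ≡.trans (≡.cong (λ i → + N ℤ.- i) (ℤ.0≤i⇒+∣i∣≡i (ℤ.i≤j⇒0≤j-i n≤N)))
                    (i-[i-j]≡j (+ N) n)

  expand-suc : ∀ f N e → expand f (suc N) (suc e) ≈ expand f N e
  expand-suc f N e = coeff-cong f (+1-+1 N e)

  expand-top : ∀ f {N} → bound f ≤ N → expand f (suc N) 0 ≈ 0#
  expand-top f {N} b≤N = trans (coeff-cong f (ℤ.+-identityʳ (+ suc N)))
                               (vanish-≤ f b≤N (ℤ.+<+ ℕ.≤-refl))

  expand-*-bound : ∀ f g →
    expand (f *ᴸ g) (bound f ℕ.+ bound g) ≈ˢ expand f (bound f) ⊛ expand g (bound g)
  expand-*-bound f g e =
    reflexive (≡.cong (cauchy f g) (i-[i-j]≡j (+ (bound f ℕ.+ bound g)) (+ e)))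

  -- Starting `d` degrees higher puts `d` zeros in front of the expansion of `f`, and these reappear
  -- in front of the product. The right factor `G` is arbitrary, so after commuting the lemma serves
  -- either factor.
  expand-raise : ∀ f h {N L G} → bound f ≤ N → bound h ≤ L → expand h L ≈ˢ expand f N ⊛ G →
    ∀ d → expand h (d ℕ.+ L) ≈ˢ expand f (d ℕ.+ N) ⊛ G
  expand-raise f h f≤N h≤L eq zero = eq
  expand-raise f h {N} {L} {G} f≤N h≤L eq (suc d) = λ where
      zero    → begin
        expand h (suc d ℕ.+ L) 0              ≈⟨ expand-top h (ℕ.m≤n⇒m≤o+n d h≤L) ⟩
        0#                                    ≈⟨ zeroˡ _ ⟨
        0# * G 0                              ≈⟨ *-congʳ top ⟨
        expand f (suc d ℕ.+ N) 0 * G 0        ≈⟨ +-identityʳ _ ⟨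
        (expand f (suc d ℕ.+ N) ⊛ G) 0        ∎
      (suc e) → begin
        expand h (suc d ℕ.+ L) (suc e)        ≈⟨ expand-suc h (d ℕ.+ L) e ⟩
        expand h (d ℕ.+ L) e                  ≈⟨ expand-raise f h f≤N h≤L eq d e ⟩
        (expand f (d ℕ.+ N) ⊛ G) e            ≈⟨ ⊛-congʳ G (expand-suc f (d ℕ.+ N)) e ⟨
        ((expand f (suc d ℕ.+ N) ∘ suc) ⊛ G) e  ≈⟨ +-identityˡ _ ⟨
        0# + ((expand f (suc d ℕ.+ N) ∘ suc) ⊛ G) e
          ≈⟨ +-congʳ (trans (*-congʳ top) (zeroˡ _)) ⟨
        (expand f (suc d ℕ.+ N) ⊛ G) (suc e)  ∎
    where
    top : expand f (suc d ℕ.+ N) 0 ≈ 0#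
    top = expand-top f (ℕ.m≤n⇒m≤o+n d f≤N)

  -- From the expansions at the exact bounds, `expand-raise` lifts first `f` and then `g`, with
  -- `⊛-comm` bringing the factor to be lifted to the left.
  expand-* : ∀ f g {N M} → bound f ≤ N → bound g ≤ M →
    expand (f *ᴸ g) (N ℕ.+ M) ≈ˢ expand f N ⊛ expand g M
  expand-* f g {N} {M} f≤N g≤M e = begin
    expand (f *ᴸ g) (N ℕ.+ M) e
      ≡⟨ ≡.cong (λ L → expand (f *ᴸ g) L e) N+M≡ ⟩
    expand (f *ᴸ g) (M ∸ bound g ℕ.+ (N ℕ.+ bound g)) e
      ≈⟨ expand-raise g (f *ᴸ g) ℕ.≤-refl (ℕ.+-monoˡ-≤ (bound g) f≤N) raised-f (M ∸ bound g) e ⟩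
    (expand g (M ∸ bound g ℕ.+ bound g) ⊛ expand f N) e
      ≡⟨ ≡.cong (λ L → (expand g L ⊛ expand f N) e) (ℕ.m∸n+n≡m g≤M) ⟩
    (expand g M ⊛ expand f N) e
      ≈⟨ ⊛-comm (expand g M) (expand f N) e ⟩
    (expand f N ⊛ expand g M) e  ∎
    where
    N+M≡ : N ℕ.+ M ≡ M ∸ bound g ℕ.+ (N ℕ.+ bound g)
    N+M≡ = ≡.trans (≡.cong (N ℕ.+_) (≡.sym (ℕ.m∸n+n≡m g≤M)))
      (≡.trans (≡.sym (ℕ.+-assoc N (M ∸ bound g) (bound g)))
      (≡.trans (≡.cong (ℕ._+ bound g) (ℕ.+-comm N (M ∸ bound g)))
               (ℕ.+-assoc (M ∸ bound g) N (bound g))))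

    N+b≡ : N ∸ bound f ℕ.+ (bound f ℕ.+ bound g) ≡ N ℕ.+ bound g
    N+b≡ = ≡.trans (≡.sym (ℕ.+-assoc (N ∸ bound f) (bound f) (bound g)))
                   (≡.cong (ℕ._+ bound g) (ℕ.m∸n+n≡m f≤N))

    raised-f : expand (f *ᴸ g) (N ℕ.+ bound g) ≈ˢ expand g (bound g) ⊛ expand f N
    raised-f i = begin
      expand (f *ᴸ g) (N ℕ.+ bound g) i
        ≡⟨ ≡.cong (λ L → expand (f *ᴸ g) L i) N+b≡ ⟨
      expand (f *ᴸ g) (N ∸ bound f ℕ.+ (bound f ℕ.+ bound g)) i
        ≈⟨ expand-raise f (f *ᴸ g) ℕ.≤-refl ℕ.≤-refl (expand-*-bound f g) (N ∸ bound f) i ⟩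
      (expand f (N ∸ bound f ℕ.+ bound f) ⊛ expand g (bound g)) i
        ≡⟨ ≡.cong (λ L → (expand f L ⊛ expand g (bound g)) i) (ℕ.m∸n+n≡m f≤N) ⟩
      (expand f N ⊛ expand g (bound g)) i
        ≈⟨ ⊛-comm (expand f N) (expand g (bound g)) i ⟩
      (expand g (bound g) ⊛ expand f N) i  ∎

  expand-constant : ∀ x → expand (constant x) 0 ≈ˢ monomial x
  expand-constant x zero    = refl
  expand-constant x (suc _) = refl

  expand-z : expand z 1 ≈ˢ monomial 1#
  expand-z zero          = refl
  expand-z (suc zero)    = refl
  expand-z (suc (suc _)) = refl

  -- Coefficients of a product are computed from the bounds of its factors, which `≈ᴸ` ignores;
  -- expanding at common bounds removes this dependence.
  *ᴸ-cong : ∀ {f f′ g g′} → f ≈ᴸ f′ → g ≈ᴸ g′ → f *ᴸ g ≈ᴸ f′ *ᴸ g′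
  *ᴸ-cong {f} {f′} {g} {g′} f≈f′ g≈g′ = expand⇒≈ (f *ᴸ g) (f′ *ᴸ g′) (N ℕ.+ M)
    (ℕ.+-mono-≤ f≤N g≤M) (ℕ.+-mono-≤ f′≤N g′≤M) λ e → begin
      expand (f *ᴸ g) (N ℕ.+ M) e      ≈⟨ expand-* f g f≤N g≤M e ⟩
      (expand f N ⊛ expand g M) e      ≈⟨ ⊛-cong (λ i → f≈f′ (+ N ℤ.- + i)) (λ i → g≈g′ (+ M ℤ.- + i)) e ⟩
      (expand f′ N ⊛ expand g′ M) e    ≈⟨ expand-* f′ g′ f′≤N g′≤M e ⟨
      expand (f′ *ᴸ g′) (N ℕ.+ M) e    ∎
    where
    N M : ℕ
    N = bound f ℕ.⊔ bound f′
    M = bound g ℕ.⊔ bound g′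
    f≤N  = ℕ.m≤m⊔n (bound f) (bound f′)
    f′≤N = ℕ.m≤n⊔m (bound f) (bound f′)
    g≤M  = ℕ.m≤m⊔n (bound g) (bound g′)
    g′≤M = ℕ.m≤n⊔m (bound g) (bound g′)

  *ᴸ-comm : ∀ f g → f *ᴸ g ≈ᴸ g *ᴸ f
  *ᴸ-comm f g = expand⇒≈ (f *ᴸ g) (g *ᴸ f) (N ℕ.+ M)
    ℕ.≤-refl (ℕ.≤-reflexive (ℕ.+-comm M N)) λ e → begin
    expand (f *ᴸ g) (N ℕ.+ M) e    ≈⟨ expand-*-bound f g e ⟩
    (expand f N ⊛ expand g M) e    ≈⟨ ⊛-comm (expand f N) (expand g M) e ⟩
    (expand g M ⊛ expand f N) e    ≈⟨ expand-*-bound g f e ⟨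
    expand (g *ᴸ f) (M ℕ.+ N) e    ≡⟨ ≡.cong (λ L → expand (g *ᴸ f) L e) (ℕ.+-comm M N) ⟩
    expand (g *ᴸ f) (N ℕ.+ M) e    ∎
    where
    N M : ℕ
    N = bound f
    M = bound g

  *ᴸ-assoc : ∀ f g h → (f *ᴸ g) *ᴸ h ≈ᴸ f *ᴸ (g *ᴸ h)
  *ᴸ-assoc f g h = expand⇒≈ (f *ᴸ g *ᴸ h) (f *ᴸ (g *ᴸ h)) (N ℕ.+ M ℕ.+ L)
    ℕ.≤-refl (ℕ.≤-reflexive (≡.sym (ℕ.+-assoc N M L))) λ e → begin
      expand (f *ᴸ g *ᴸ h) (N ℕ.+ M ℕ.+ L) e
        ≈⟨ expand-*-bound (f *ᴸ g) h e ⟩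
      (expand (f *ᴸ g) (N ℕ.+ M) ⊛ expand h L) e
        ≈⟨ ⊛-congʳ (expand h L) (expand-*-bound f g) e ⟩
      (expand f N ⊛ expand g M ⊛ expand h L) e
        ≈⟨ ⊛-assoc (expand f N) (expand g M) (expand h L) e ⟩
      (expand f N ⊛ (expand g M ⊛ expand h L)) e
        ≈⟨ ⊛-congˡ (expand f N) (expand-*-bound g h) e ⟨
      (expand f N ⊛ expand (g *ᴸ h) (M ℕ.+ L)) e
        ≈⟨ expand-*-bound f (g *ᴸ h) e ⟨
      expand (f *ᴸ (g *ᴸ h)) (N ℕ.+ (M ℕ.+ L)) e
        ≡⟨ ≡.cong (λ B → expand (f *ᴸ (g *ᴸ h)) B e) (ℕ.+-assoc N M L) ⟨
      expand (f *ᴸ (g *ᴸ h)) (N ℕ.+ M ℕ.+ L) e  ∎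
    where
    N M L : ℕ
    N = bound f
    M = bound g
    L = bound h

  *ᴸ-distribʳ : ∀ h f g → (f +ᴸ g) *ᴸ h ≈ᴸ f *ᴸ h +ᴸ g *ᴸ h
  *ᴸ-distribʳ h f g = expand⇒≈ ((f +ᴸ g) *ᴸ h) (f *ᴸ h +ᴸ g *ᴸ h) (N ℕ.+ L)
    ℕ.≤-refl (ℕ.⊔-lub (ℕ.+-monoˡ-≤ L f≤N) (ℕ.+-monoˡ-≤ L g≤N)) λ e → begin
      expand ((f +ᴸ g) *ᴸ h) (N ℕ.+ L) e
        ≈⟨ expand-*-bound (f +ᴸ g) h e ⟩
      (expand (f +ᴸ g) N ⊛ expand h L) e
        ≈⟨ ⊛-distribʳ (expand f N) (expand g N) (expand h L) e ⟩
      (expand f N ⊛ expand h L) e + (expand g N ⊛ expand h L) e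
        ≈⟨ +-cong (expand-* f h f≤N ℕ.≤-refl e) (expand-* g h g≤N ℕ.≤-refl e) ⟨
      expand (f *ᴸ h +ᴸ g *ᴸ h) (N ℕ.+ L) e  ∎
    where
    N L : ℕ
    N = bound f ℕ.⊔ bound g
    L = bound h
    f≤N = ℕ.m≤m⊔n (bound f) (bound g)
    g≤N = ℕ.m≤n⊔m (bound f) (bound g)

  scale : ∣K∣ → Laurent → Laurent
  scale x f .coeff n = x * coeff f n
  scale x f .bound   = bound f
  scale x f .vanish b<n = trans (*-congˡ (vanish f b<n)) (zeroʳ x)

  constant-* : ∀ x f → constant x *ᴸ f ≈ᴸ scale x f
  constant-* x f = expand⇒≈ (constant x *ᴸ f) (scale x f) (bound f)
    ℕ.≤-refl ℕ.≤-refl λ e → begin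
    expand (constant x *ᴸ f) (bound f) e              ≈⟨ expand-*-bound (constant x) f e ⟩
    (expand (constant x) 0 ⊛ expand f (bound f)) e
      ≈⟨ ⊛-congʳ (expand f (bound f)) (expand-constant x) e ⟩
    (monomial x ⊛ expand f (bound f)) e               ≈⟨ ⊛-monomialˡ x (expand f (bound f)) e ⟩
    x * expand f (bound f) e                          ∎

  -- The product of `z` and `f` with explicit coefficients; through it equations in `z` become
  -- recurrences between degrees.
  shift : Laurent → Laurent
  shift f .coeff n = coeff f (n ℤ.- + 1)
  shift f .bound   = suc (bound f)
  shift f .vanish b<n = vanish f (ℤ.+-monoˡ-< (ℤ.- + 1) b<n)

  z-* : ∀ f → z *ᴸ f ≈ᴸ shift f
  z-* f = expand⇒≈ (z *ᴸ f) (shift f) (suc (bound f))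
    ℕ.≤-refl ℕ.≤-refl λ e → begin
    expand (z *ᴸ f) (suc (bound f)) e          ≈⟨ expand-*-bound z f e ⟩
    (expand z 1 ⊛ expand f (bound f)) e        ≈⟨ ⊛-congʳ (expand f (bound f)) expand-z e ⟩
    (monomial 1# ⊛ expand f (bound f)) e       ≈⟨ ⊛-monomialˡ 1# (expand f (bound f)) e ⟩
    1# * expand f (bound f) e                  ≈⟨ *-identityˡ _ ⟩
    expand f (bound f) e                       ≈⟨ coeff-cong f (1+b-e-1 (bound f) e) ⟨
    coeff f (+ suc (bound f) ℤ.- + e ℤ.- + 1)  ∎
    where
    1+b-e-1 : ∀ b e → + suc b ℤ.- + e ℤ.- + 1 ≡ + b ℤ.- + e
    1+b-e-1 b e = ≡.trans (ℤ.+-assoc (+ suc b) (ℤ.- + e) (ℤ.- + 1))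
      (≡.trans (≡.cong (λ i → + suc b ℤ.+ i) (ℤ.+-comm (ℤ.- + e) (ℤ.- + 1)))
               (≡.sym (ℤ.+-assoc (+ suc b) (ℤ.- + 1) (ℤ.- + e))))

  constant-0 : ∀ n → coeff (constant 0#) n ≈ 0#
  constant-0 (+ zero)  = refl
  constant-0 (+ suc _) = refl
  constant-0 -[1+ _ ]  = refl

  laurentCommutativeRing : CommutativeRing (c ⊔ ℓ₁) ℓ₁
  laurentCommutativeRing = record
    { RawRing laurentRing
    ; isCommutativeRing = record
      { isRing = record
        { +-isAbelianGroup = record
          { isGroup = record
            { isMonoid = record
              { isSemigroup = record
                { isMagma = record
                  { isEquivalence = record
                    { refl  = λ _ → refl
                    ; sym   = λ f≈g n → sym (f≈g n)
                    ; trans = λ f≈g g≈h n → trans (f≈g n) (g≈h n)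
                    }
                  ; ∙-cong = λ f≈f′ g≈g′ n → +-cong (f≈f′ n) (g≈g′ n)
                  }
                ; assoc = λ f g h n → +-assoc _ _ _
                }
              ; identity = (λ f n → trans (+-congʳ (constant-0 n)) (+-identityˡ _))
                         , (λ f n → trans (+-congˡ (constant-0 n)) (+-identityʳ _))
              }
            ; inverse = (λ f n → trans (-‿inverseˡ _) (sym (constant-0 n)))
                      , (λ f n → trans (-‿inverseʳ _) (sym (constant-0 n)))
            ; ⁻¹-cong = λ f≈g n → -‿cong (f≈g n)
            }
          ; comm = λ f g n → +-comm _ _
          }
        ; *-cong     = *ᴸ-cong
        ; *-assoc    = *ᴸ-assoc
        ; *-identity = *-idˡ , λ f n → trans (*ᴸ-comm f (constant 1#) n) (*-idˡ f n)
        ; distrib    = (λ h f g n → trans (*ᴸ-comm h (f +ᴸ g) n) (trans (*ᴸ-distribʳ h f g n)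
                          (+-cong (*ᴸ-comm f h n) (*ᴸ-comm g h n))))
                     , *ᴸ-distribʳ
        }
      ; *-comm = *ᴸ-comm
      }
    }
    where
    *-idˡ : ∀ f → constant 1# *ᴸ f ≈ᴸ f
    *-idˡ f n = trans (constant-* 1# f n) (*-identityˡ _)

-- Sums against Kronecker deltas.

module Identity {c ℓ} (R : CommutativeRing c ℓ) where
  open CommutativeRing R hiding (zero)
  open Matrices rawRing using (1ᴹ)
  open SemiringSum semiring
  open RingProperties ring using (-0#≈0#; -‿+-comm)

  δ : ℕ → ℕ → Carrier
  δ i j = if does (i ℕ.≟ j) then 1# else 0#

  sum-0 : ∀ {n} (t : Fin n → Carrier) → (∀ m → t m ≈ 0#) → sum t ≈ 0#
  sum-0 {n} t t≈0 = trans (sum-cong-≋ t≈0) (sum-replicate-zero n)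

  sum-neg : ∀ {n} (t : Fin n → Carrier) → sum (λ m → - t m) ≈ - sum t
  sum-neg {zero}  t = sym -0#≈0#
  sum-neg {suc n} t = trans (+-congˡ (sum-neg (t ∘ suc))) (-‿+-comm (t zero) (sum (t ∘ suc)))

  -- The index `i` is either in the range of summation, or past it, where the hypothesis makes the
  -- missing term zero.
  sum-δ : ∀ n i (x : ℕ → Carrier) → (n ≤ i → x i ≈ 0#) →
    ∑[ m < n ] (δ i (toℕ m) * x (toℕ m)) ≈ x i
  sum-δ zero    i       x x≈0 = sym (x≈0 ℕ.z≤n)
  sum-δ (suc n) zero    x x≈0 = trans
    (+-cong (*-identityˡ (x 0)) (sum-0 {n} _ λ m → zeroˡ (x (suc (toℕ m))))) (+-identityʳ (x 0))
  sum-δ (suc n) (suc i) x x≈0 = trans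
    (+-cong (zeroˡ (x 0)) (sum-δ n i (x ∘ suc) (x≈0 ∘ ℕ.s≤s))) (+-identityˡ (x (suc i)))

  sum-1ᴹˡ : ∀ {n} (i : Fin n) (x : Fin n → Carrier) → ∑[ m < n ] (1ᴹ i m * x m) ≈ x i
  sum-1ᴹˡ zero    x = trans
    (+-cong (*-identityˡ (x zero)) (sum-0 _ λ m → zeroˡ (x (suc m)))) (+-identityʳ (x zero))
  sum-1ᴹˡ (suc i) x = trans (+-cong (zeroˡ (x zero)) (sum-1ᴹˡ i (x ∘ suc))) (+-identityˡ (x (suc i)))

  sum-1ᴹʳ : ∀ {n} (j : Fin n) (x : Fin n → Carrier) → ∑[ m < n ] (x m * 1ᴹ m j) ≈ x j
  sum-1ᴹʳ zero    x = trans
    (+-cong (*-identityʳ (x zero)) (sum-0 _ λ m → zeroʳ (x (suc m)))) (+-identityʳ (x zero))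
  sum-1ᴹʳ (suc j) x = trans (+-cong (zeroʳ (x zero)) (sum-1ᴹʳ j (x ∘ suc))) (+-identityˡ (x (suc j)))

-- Linear systems with infinitely many unknowns.

-- Row i of the coefficient matrix h is supported on the columns l ≤ i + q.
module RowFiniteSystem {c ℓ} (R : CommutativeRing c ℓ) (z : CommutativeRing.Carrier R) (q : ℕ) where
  open CommutativeRing R hiding (zero)
  open SemiringSum semiring
  open CommutativeSemigroupProperties +-commutativeSemigroup using (interchange)
  open Identity R
  open SetoidReasoning setoid

  -- The system (z - h) u = w, with the finite row support making each equation a finite sum.
  Solves : (ℕ → ℕ → Carrier) → (w u : ℕ → Carrier) → Set ℓ
  Solves h w u = ∀ i → z * u i ≈ w i + ∑[ l ≤ i ℕ.+ q ] (h i (toℕ l) * u (toℕ l))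

  -- Columnwise form of (z - h) φ = 1.
  IsResolvent : (h φ : ℕ → ℕ → Carrier) → Set ℓ
  IsResolvent h φ = ∀ j → Solves h (λ i → δ i j) (λ i → φ i j)

  solves-congʰ : ∀ h h′ w u → (∀ i l → h i l ≈ h′ i l) → Solves h w u → Solves h′ w u
  solves-congʰ h h′ w u h≈h′ s i = trans (s i)
    (+-congˡ (sum-cong-≋ {suc (i ℕ.+ q)} λ l → *-congʳ {u (toℕ l)} (h≈h′ i (toℕ l))))

  module _ (h : ℕ → ℕ → Carrier) where

    solves-congˡ : ∀ {w w′ u} → (∀ i → w i ≈ w′ i) → Solves h w u → Solves h w′ u
    solves-congˡ w≈w′ s i = trans (s i) (+-congʳ (w≈w′ i))

    solves-0 : Solves h (λ _ → 0#) (λ _ → 0#)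
    solves-0 i = trans (zeroʳ z)
      (sym (trans (+-identityˡ _) (sum-0 {suc (i ℕ.+ q)} _ λ l → zeroʳ (h i (toℕ l)))))

    solves-+ : ∀ {w w′ u u′} → Solves h w u → Solves h w′ u′ →
      Solves h (λ i → w i + w′ i) (λ i → u i + u′ i)
    solves-+ {w} {w′} {u} {u′} s s′ i = begin
      z * (u i + u′ i)                     ≈⟨ distribˡ z (u i) (u′ i) ⟩
      z * u i + z * u′ i                   ≈⟨ +-cong (s i) (s′ i) ⟩
      (w i + sum hu) + (w′ i + sum hu′)    ≈⟨ interchange (w i) (sum hu) (w′ i) (sum hu′) ⟩
      (w i + w′ i) + (sum hu + sum hu′)    ≈⟨ +-congˡ (∑-distrib-+ hu hu′) ⟨
      (w i + w′ i) + sum (λ l → hu l + hu′ l)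
        ≈⟨ +-congˡ (sum-cong-≋ {suc (i ℕ.+ q)} λ l → distribˡ (h i (toℕ l)) (u (toℕ l)) (u′ (toℕ l))) ⟨
      (w i + w′ i) + ∑[ l ≤ i ℕ.+ q ] (h i (toℕ l) * (u (toℕ l) + u′ (toℕ l)))  ∎
      where
      hu hu′ : Fin (suc (i ℕ.+ q)) → Carrier
      hu  l = h i (toℕ l) * u (toℕ l)
      hu′ l = h i (toℕ l) * u′ (toℕ l)

    solves-*ʳ : ∀ {w u} x → Solves h w u → Solves h (λ i → w i * x) (λ i → u i * x)
    solves-*ʳ {w} {u} x s i = begin
      z * (u i * x)                          ≈⟨ *-assoc z (u i) x ⟨
      z * u i * x                            ≈⟨ *-congʳ (s i) ⟩
      (w i + sum hu) * x                     ≈⟨ distribʳ x (w i) (sum hu) ⟩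
      w i * x + sum hu * x                   ≈⟨ +-congˡ (*-distribʳ-sum x hu) ⟩
      w i * x + sum (λ l → hu l * x)
        ≈⟨ +-congˡ (sum-cong-≋ {suc (i ℕ.+ q)} λ l → *-assoc (h i (toℕ l)) (u (toℕ l)) x) ⟩
      w i * x + ∑[ l ≤ i ℕ.+ q ] (h i (toℕ l) * (u (toℕ l) * x))  ∎
      where
      hu : Fin (suc (i ℕ.+ q)) → Carrier
      hu l = h i (toℕ l) * u (toℕ l)

    solves-sum : ∀ {n} {w u : Fin n → ℕ → Carrier} → (∀ m → Solves h (w m) (u m)) →
      Solves h (λ i → ∑[ m < n ] w m i) (λ i → ∑[ m < n ] u m i)
    solves-sum {zero}  s = solves-0
    solves-sum {suc n} s = solves-+ (s zero) (solves-sum (s ∘ suc))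

-- Products with matrices that differ from the identity in the last row or column.

module BorderedMatrix {c ℓ} (R : CommutativeRing c ℓ) (q-1 p-1 : ℕ) where
  open CommutativeRing R hiding (zero)
  open Matrices rawRing
  open SemiringSum semiring
  open Identity R
  open RingProperties ring using (-‿distribˡ-*)
  open SetoidReasoning setoid

  private
    q p : ℕ
    q = suc q-1
    p = suc p-1

  IdentityUpToLastRow : Matrix q q → (Fin q → Carrier) → Set ℓ
  IdentityUpToLastRow P row =
    (∀ i j → P (inject₁ i) j ≈ 1ᴹ (inject₁ i) j) × (∀ j → P (fromℕ q-1) j ≈ row j)

  IdentityUpToLastColumn : Matrix p p → (Fin p → Carrier) → Set ℓ
  IdentityUpToLastColumn Q col =
    (∀ i j → Q i (inject₁ j) ≈ 1ᴹ i (inject₁ j)) × (∀ i → Q i (fromℕ p-1) ≈ col i)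

  module _ (P : Matrix q q) {row : Fin q → Carrier}
           (P-border : IdentityUpToLastRow P (λ j → - row j)) (X : Matrix q p) where

    *ᴹ-inject₁ˡ : ∀ i j → (P *ᴹ X) (inject₁ i) j ≈ X (inject₁ i) j
    *ᴹ-inject₁ˡ i j = trans (sum-cong-≋ {q} λ l → *-congʳ {X l j} (proj₁ P-border i l))
                            (sum-1ᴹˡ (inject₁ i) (λ l → X l j))

    *ᴹ-lastˡ : ∀ j → (P *ᴹ X) (fromℕ q-1) j ≈ - ∑[ l < q ] (row l * X l j)
    *ᴹ-lastˡ j = trans
      (sum-cong-≋ {q} λ l → trans (*-congʳ {X l j} (proj₂ P-border l)) (sym (-‿distribˡ-* (row l) (X l j))))
      (sum-neg λ l → row l * X l j)

    module _ (Q : Matrix p p) {col : Fin p → Carrier}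
             (Q-border : IdentityUpToLastColumn Q col) where

      *ᴹ-inject₁ʳ : ∀ i j → (P *ᴹ X *ᴹ Q) i (inject₁ j) ≈ (P *ᴹ X) i (inject₁ j)
      *ᴹ-inject₁ʳ i j = trans (sum-cong-≋ {p} λ m → *-congˡ {(P *ᴹ X) i m} (proj₁ Q-border m j))
                              (sum-1ᴹʳ (inject₁ j) ((P *ᴹ X) i))

      *ᴹ-lastʳ : ∀ i → (P *ᴹ X *ᴹ Q) i (fromℕ p-1) ≈ ∑[ m < p ] ((P *ᴹ X) i m * col m)
      *ᴹ-lastʳ i = sum-cong-≋ {p} λ m → *-congˡ {(P *ᴹ X) i m} (proj₂ Q-border m)

      *ᴹ-inner : ∀ i j → (P *ᴹ X *ᴹ Q) (inject₁ i) (inject₁ j) ≈ X (inject₁ i) (inject₁ j)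
      *ᴹ-inner i j = trans (*ᴹ-inject₁ʳ (inject₁ i) j) (*ᴹ-inject₁ˡ i (inject₁ j))

      *ᴹ-bottom : ∀ j → (P *ᴹ X *ᴹ Q) (fromℕ q-1) (inject₁ j) ≈ - ∑[ l < q ] (row l * X l (inject₁ j))
      *ᴹ-bottom j = trans (*ᴹ-inject₁ʳ (fromℕ q-1) j) (*ᴹ-lastˡ (inject₁ j))

      *ᴹ-right : ∀ i → (P *ᴹ X *ᴹ Q) (inject₁ i) (fromℕ p-1) ≈ ∑[ m < p ] (X (inject₁ i) m * col m)
      *ᴹ-right i = trans (*ᴹ-lastʳ (inject₁ i)) (sum-cong-≋ {p} λ m → *-congʳ {col m} (*ᴹ-inject₁ˡ i m))

      -- Only here do both borders act. Exchanging the two sums groups the result as the row applied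
      -- to X times the column, the form of the correction in the Schur complement.
      *ᴹ-corner : (P *ᴹ X *ᴹ Q) (fromℕ q-1) (fromℕ p-1) ≈
        - ∑[ l < q ] (row l * ∑[ m < p ] (X l m * col m))
      *ᴹ-corner = begin
        (P *ᴹ X *ᴹ Q) (fromℕ q-1) (fromℕ p-1)
          ≈⟨ *ᴹ-lastʳ (fromℕ q-1) ⟩
        ∑[ m < p ] ((P *ᴹ X) (fromℕ q-1) m * col m)
          ≈⟨ sum-cong-≋ {p} (λ m → trans (*-congʳ {col m} (*ᴹ-lastˡ m)) (sym (-‿distribˡ-* (rowX m) (col m)))) ⟩
        ∑[ m < p ] (- (rowX m * col m))
          ≈⟨ sum-neg (λ m → rowX m * col m) ⟩
        - ∑[ m < p ] (rowX m * col m)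
          ≈⟨ -‿cong (sum-cong-≋ {p} λ m → *-distribʳ-sum {q} (col m) (λ l → row l * X l m)) ⟩
        - ∑[ m < p ] ∑[ l < q ] (row l * X l m * col m)
          ≈⟨ -‿cong (∑-comm {p} {q} λ m l → row l * X l m * col m) ⟩
        - ∑[ l < q ] ∑[ m < p ] (row l * X l m * col m)
          ≈⟨ -‿cong (sum-cong-≋ {q} λ l → trans
               (sum-cong-≋ {p} λ m → *-assoc (row l) (X l m) (col m))
               (sym (*-distribˡ-sum {p} (row l) λ m → X l m * col m))) ⟩
        - ∑[ l < q ] (row l * ∑[ m < p ] (X l m * col m))  ∎
        where
        rowX : Fin p → Carrier
        rowX m = ∑[ l < q ] (row l * X l m)

-- The bordered resolvent and its pseudo-quotient.

module SchurComplement {c ℓ} (R : CommutativeRing c ℓ) (z : CommutativeRing.Carrier R) (p-1 q-1 : ℕ)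
  (h φ φ′ : ℕ → ℕ → CommutativeRing.Carrier R) where
  open CommutativeRing R hiding (zero)
  open SemiringSum semiring
  open Identity R
  open Matrices rawRing
  open BorderedMatrix R q-1 p-1

  p q : ℕ
  p = suc p-1
  q = suc q-1

  open RowFiniteSystem R z q
  open RingProperties ring using (-‿distribˡ-*; -‿+-comm)
  open CommutativeSemigroupProperties +-commutativeSemigroup using (x∙yz≈y∙xz)
  open SetoidReasoning setoid

  h′ : ℕ → ℕ → Carrier
  h′ i j = h (suc i) (suc j)

  row col : ℕ → Carrier
  row j = h 0 (suc j)
  col i = h (suc i) 0

  -- Stopping at `p` gives the full product of `φ′` with the first column once `col-0` is assumed.
  S : ℕ → Carrier
  S i = ∑[ m < p ] (φ′ i (toℕ m) * col (toℕ m))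

  E D : Carrier
  E = h 0 0 + ∑[ l < q ] (row (toℕ l) * S (toℕ l))
  D = z - E

  -- The columns of `φ′` shifted right by one, so that column `j` of `ψ` belongs to column `j` of
  -- `φ`.
  ψ : ℕ → ℕ → Carrier
  ψ i zero    = 0#
  ψ i (suc j) = φ′ i j

  -- Regular abstracts "no terms of positive degree", which makes solutions unique.
  module Entries {ℓ′}
    (Regular : Carrier → Set ℓ′)
    (regular-0 : Regular 0#)
    (regular-+ : ∀ {x y} → Regular x → Regular y → Regular (x + y))
    (regular-* : ∀ {x y} → Regular x → Regular y → Regular (x * y))
    (regular-col : ∀ i → Regular (col i))
    (regular-φ : ∀ i j → Regular (φ i j))
    (regular-φ′ : ∀ i j → Regular (φ′ i j))
    (unique : ∀ {w u v} → (∀ i → Regular (u i)) → (∀ i → Regular (v i)) →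
              Solves h′ w u → Solves h′ w v → ∀ i → u i ≈ v i)
    (col-0 : ∀ i → p ≤ i → col i ≈ 0#)
    (φ-resolvent : IsResolvent h φ)
    (φ′-resolvent : IsResolvent h′ φ′)
    where

    regular-sum : ∀ {n} {t : Fin n → Carrier} → (∀ m → Regular (t m)) → Regular (sum t)
    regular-sum {zero}  r = regular-0
    regular-sum {suc n} r = regular-+ (r zero) (regular-sum (r ∘ suc))

    regular-S : ∀ i → Regular (S i)
    regular-S i = regular-sum {p} λ m → regular-* (regular-φ′ i (toℕ m)) (regular-col (toℕ m))

    regular-ψ : ∀ i j → Regular (ψ i j)
    regular-ψ i zero    = regular-0
    regular-ψ i (suc j) = regular-φ′ i j

    -- A linear combination of the columns of `φ′`; its right-hand side, the same combination of
    -- unit vectors, is `col` itself.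
    S-solves : Solves h′ col S
    S-solves = solves-congˡ h′ (λ i → sum-δ p i col (col-0 i))
      (solves-sum h′ {p} λ m → solves-*ʳ h′ (col (toℕ m)) (φ′-resolvent (toℕ m)))

    ψ-solves : ∀ j → Solves h′ (λ i → δ (suc i) j) (λ i → ψ i j)
    ψ-solves zero    = solves-0 h′
    ψ-solves (suc j) = φ′-resolvent j

    φ-below : ∀ i j → φ (suc i) j ≈ ψ i j + S i * φ 0 j
    φ-below i j = unique
      (λ i → regular-φ (suc i) j)
      (λ i → regular-+ (regular-ψ i j) (regular-* (regular-S i) (regular-φ 0 j)))
      -- In row `suc i` of the system for `h`, the term at index 0 is `col i * φ 0 j`. Moved into
      -- the right-hand side, it leaves row `i` of a system over `h′`.
      (λ i → trans (φ-resolvent j (suc i)) (sym (+-assoc _ _ _)))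
      (solves-+ h′ (ψ-solves j) (solves-*ʳ h′ (φ 0 j) S-solves))
      i

    -- Row 0 of the resolvent equation, with `φ-below` eliminating all entries beneath the top one;
    -- the multiples of `φ 0 j` collect into `E`.
    zφ-top : ∀ j → z * φ 0 j ≈ (δ 0 j + ∑[ l < q ] (row (toℕ l) * ψ (toℕ l) j)) + E * φ 0 j
    zφ-top j = begin
      z * φ 0 j
        ≈⟨ φ-resolvent j 0 ⟩
      δ 0 j + (h 0 0 * φ 0 j + ∑[ l < q ] (row (toℕ l) * φ (suc (toℕ l)) j))
        ≈⟨ +-congˡ (+-congˡ rowφ) ⟩
      δ 0 j + (h 0 0 * φ 0 j + (rψ + rS * φ 0 j))
        ≈⟨ +-congˡ (x∙yz≈y∙xz _ _ _) ⟩
      δ 0 j + (rψ + (h 0 0 * φ 0 j + rS * φ 0 j))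
        ≈⟨ +-assoc _ _ _ ⟨
      (δ 0 j + rψ) + (h 0 0 * φ 0 j + rS * φ 0 j)
        ≈⟨ +-congˡ (distribʳ _ _ _) ⟨
      (δ 0 j + rψ) + E * φ 0 j  ∎
      where
      rψ rS : Carrier
      rψ = ∑[ l < q ] (row (toℕ l) * ψ (toℕ l) j)
      rS = ∑[ l < q ] (row (toℕ l) * S (toℕ l))

      rowφ : ∑[ l < q ] (row (toℕ l) * φ (suc (toℕ l)) j) ≈ rψ + rS * φ 0 j
      rowφ = begin
        ∑[ l < q ] (row (toℕ l) * φ (suc (toℕ l)) j)
          ≈⟨ sum-cong-≋ {q} (λ l → trans
               (*-congˡ {row (toℕ l)} (φ-below (toℕ l) j))
               (distribˡ (row (toℕ l)) (ψ (toℕ l) j) (S (toℕ l) * φ 0 j))) ⟩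
        ∑[ l < q ] (row (toℕ l) * ψ (toℕ l) j + row (toℕ l) * (S (toℕ l) * φ 0 j))
          ≈⟨ ∑-distrib-+ {q} (λ l → row (toℕ l) * ψ (toℕ l) j) (λ l → row (toℕ l) * (S (toℕ l) * φ 0 j)) ⟩
        rψ + ∑[ l < q ] (row (toℕ l) * (S (toℕ l) * φ 0 j))
          ≈⟨ +-congˡ (sum-cong-≋ {q} λ l → sym (*-assoc (row (toℕ l)) (S (toℕ l)) (φ 0 j))) ⟩
        rψ + ∑[ l < q ] (row (toℕ l) * S (toℕ l) * φ 0 j)
          ≈⟨ +-congˡ (*-distribʳ-sum {q} (φ 0 j) λ l → row (toℕ l) * S (toℕ l)) ⟨
        rψ + rS * φ 0 j  ∎

    x+y-y≈x : ∀ x y → x + y - y ≈ x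
    x+y-y≈x x y = trans (+-assoc x y (- y)) (trans (+-congˡ (-‿inverseʳ y)) (+-identityʳ x))

    D*φ-top : ∀ j → D * φ 0 j ≈ δ 0 j + ∑[ l < q ] (row (toℕ l) * ψ (toℕ l) j)
    D*φ-top j = begin
      (z - E) * φ 0 j                 ≈⟨ distribʳ (φ 0 j) z (- E) ⟩
      z * φ 0 j + - E * φ 0 j         ≈⟨ +-cong (zφ-top j) (sym (-‿distribˡ-* E (φ 0 j))) ⟩
      _ + E * φ 0 j - E * φ 0 j       ≈⟨ x+y-y≈x _ (E * φ 0 j) ⟩
      δ 0 j + ∑[ l < q ] (row (toℕ l) * ψ (toℕ l) j)  ∎

    D*φ₀₀ : D * φ 0 0 ≈ 1#
    D*φ₀₀ = trans (D*φ-top 0)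
      (trans (+-congˡ (sum-0 {q} _ λ l → zeroʳ (row (toℕ l)))) (+-identityʳ 1#))

    φ₀₀*D : φ 0 0 * D ≈ 1#
    φ₀₀*D = trans (*-comm (φ 0 0) D) D*φ₀₀

    φ-top*D : ∀ j → φ 0 (suc j) * D ≈ ∑[ l < q ] (row (toℕ l) * φ′ (toℕ l) j)
    φ-top*D j = trans (*-comm _ D) (trans (D*φ-top (suc j)) (+-identityˡ _))

    φ-left*D : ∀ i → φ (suc i) 0 * D ≈ S i
    φ-left*D i = begin
      φ (suc i) 0 * D            ≈⟨ *-congʳ (trans (φ-below i 0) (+-identityˡ _)) ⟩
      S i * φ 0 0 * D            ≈⟨ *-assoc (S i) (φ 0 0) D ⟩
      S i * (φ 0 0 * D)          ≈⟨ *-congˡ φ₀₀*D ⟩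
      S i * 1#                   ≈⟨ *-identityʳ (S i) ⟩
      S i                        ∎

    -- As `D` inverts `φ 0 0`, the left side is `φ (suc i) (suc j)` minus `S i * φ 0 (suc j)`, which
    -- is exactly the correction in `φ-below`.
    φ-minor*D : ∀ i j →
      (φ (suc i) (suc j) * φ 0 0 - φ 0 (suc j) * φ (suc i) 0) * D ≈ φ′ i j
    φ-minor*D i j = begin
      (x * φ 0 0 - y * φ (suc i) 0) * D
        ≈⟨ distribʳ D (x * φ 0 0) (- (y * φ (suc i) 0)) ⟩
      x * φ 0 0 * D + - (y * φ (suc i) 0) * D
        ≈⟨ +-cong (*-assoc x (φ 0 0) D) (sym (-‿distribˡ-* (y * φ (suc i) 0) D)) ⟩
      x * (φ 0 0 * D) - y * φ (suc i) 0 * D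
        ≈⟨ +-cong (trans (*-congˡ φ₀₀*D) (*-identityʳ x))
                  (-‿cong (trans (*-assoc y (φ (suc i) 0) D) (*-congˡ (φ-left*D i)))) ⟩
      x - y * S i
        ≈⟨ +-cong (φ-below i (suc j)) (-‿cong (*-comm y (S i))) ⟩
      φ′ i j + S i * y - S i * y
        ≈⟨ x+y-y≈x (φ′ i j) (S i * y) ⟩
      φ′ i j  ∎
      where
      x y : Carrier
      x = φ (suc i) (suc j)
      y = φ 0 (suc j)

    F F′ : Matrix q p
    F  i j = φ (toℕ i) (toℕ j)
    F′ i j = φ′ (toℕ i) (toℕ j)

    module _ (A : Matrix q p) (P : Matrix q q) (Q : Matrix p p)
      (A-inject₁ˡ : ∀ i j → A (inject₁ i) j ≈ 0#)
      (A-inject₁ʳ : ∀ i j → A i (inject₁ j) ≈ 0#)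
      (A-corner : A (fromℕ q-1) (fromℕ p-1) ≈ z - h 0 0)
      (P-border : IdentityUpToLastRow P (λ j → - row (toℕ j)))
      (Q-border : IdentityUpToLastColumn Q (λ i → col (toℕ i)))
      where

      -- The four cases of `T` are four blocks: `φ′` inside, minus the row times `φ′` at the bottom,
      -- `S` on the right, and `D` in the corner.
      T[F]-entries : A +ᴹ P *ᴹ F′ *ᴹ Q ≈ᴹ T F D
      T[F]-entries i j with view i | view j
      ... | ‵inject₁ i′ | ‵inject₁ j′ = begin
        A (inject₁ i′) (inject₁ j′) + (P *ᴹ F′ *ᴹ Q) (inject₁ i′) (inject₁ j′)
          ≈⟨ +-cong (A-inject₁ˡ i′ (inject₁ j′)) (*ᴹ-inner P P-border F′ Q Q-border i′ j′) ⟩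
        0# + F′ (inject₁ i′) (inject₁ j′)
          ≈⟨ +-identityˡ _ ⟩
        φ′ (toℕ (inject₁ i′)) (toℕ (inject₁ j′))
          ≡⟨ ≡.cong₂ φ′ (toℕ-inject₁ i′) (toℕ-inject₁ j′) ⟩
        φ′ (toℕ i′) (toℕ j′)
          ≈⟨ φ-minor*D (toℕ i′) (toℕ j′) ⟨
        _ ∎
      ... | ‵fromℕ      | ‵inject₁ j′ = begin
        A (fromℕ q-1) (inject₁ j′) + (P *ᴹ F′ *ᴹ Q) (fromℕ q-1) (inject₁ j′)
          ≈⟨ +-cong (A-inject₁ʳ (fromℕ q-1) j′) (*ᴹ-bottom P P-border F′ Q Q-border j′) ⟩
        0# - ∑[ l < q ] (row (toℕ l) * φ′ (toℕ l) (toℕ (inject₁ j′)))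
          ≈⟨ +-identityˡ _ ⟩
        - ∑[ l < q ] (row (toℕ l) * φ′ (toℕ l) (toℕ (inject₁ j′)))
          ≈⟨ -‿cong (φ-top*D (toℕ (inject₁ j′))) ⟨
        - (φ 0 (suc (toℕ (inject₁ j′))) * D)
          ≡⟨ ≡.cong (λ n → - (φ 0 (suc n) * D)) (toℕ-inject₁ j′) ⟩
        - (φ 0 (suc (toℕ j′)) * D)  ∎
      ... | ‵inject₁ i′ | ‵fromℕ      = begin
        A (inject₁ i′) (fromℕ p-1) + (P *ᴹ F′ *ᴹ Q) (inject₁ i′) (fromℕ p-1)
          ≈⟨ +-cong (A-inject₁ˡ i′ (fromℕ p-1)) (*ᴹ-right P P-border F′ Q Q-border i′) ⟩
        0# + S (toℕ (inject₁ i′))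
          ≈⟨ +-identityˡ _ ⟩
        S (toℕ (inject₁ i′))
          ≡⟨ ≡.cong S (toℕ-inject₁ i′) ⟩
        S (toℕ i′)
          ≈⟨ φ-left*D (toℕ i′) ⟨
        φ (suc (toℕ i′)) 0 * D  ∎
      ... | ‵fromℕ      | ‵fromℕ      = begin
        A (fromℕ q-1) (fromℕ p-1) + (P *ᴹ F′ *ᴹ Q) (fromℕ q-1) (fromℕ p-1)
          ≈⟨ +-cong A-corner (*ᴹ-corner P P-border F′ Q Q-border) ⟩
        z - h 0 0 - rowS
          ≈⟨ +-assoc z (- h 0 0) (- rowS) ⟩
        z + (- h 0 0 - rowS)
          ≈⟨ +-congˡ (-‿+-comm (h 0 0) rowS) ⟩
        D  ∎
        where
        rowS : Carrier
        rowS = ∑[ l < q ] (row (toℕ l) * S (toℕ l))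

      -- The Schur complement `D` is itself the required inverse of the entry `φ 0 0`.
      F≈𝟏/ : F ≈𝟏/ A +ᴹ P *ᴹ F′ *ᴹ Q
      F≈𝟏/ = (D , D*φ₀₀ , φ₀₀*D) , T[F]-entries

-- Uniqueness of solutions in Laurent series.

module LaurentSystem {c ℓ₁ ℓ₂} (K : HeytingField c ℓ₁ ℓ₂) (q : ℕ) where
  open HeytingCommutativeRing (HeytingField.heytingCommutativeRing K) using (commutativeRing)
  open CommutativeRing commutativeRing hiding (zero) renaming (Carrier to ∣K∣)
  open SemiringSum semiring using (sum; sum-cong-≋)
  open LaurentSeries K
  open LaurentProperties K
  open RowFiniteSystem laurentCommutativeRing z q
  open SemiringSum (CommutativeRing.semiring laurentCommutativeRing) using () renaming (sum to sumᴸ)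
  open SetoidReasoning setoid

  coeff-sum : ∀ {m} (t : Fin m → Laurent) n → coeff (sumᴸ t) n ≈ sum (λ l → coeff (t l) n)
  coeff-sum {zero}  t n = constant-0 n
  coeff-sum {suc m} t n = +-congˡ (coeff-sum (t ∘ suc) n)

  coeff-combination : ∀ {m} (x : Fin m → ∣K∣) (u : Fin m → Laurent) n →
    coeff (sumᴸ (λ l → constant (x l) *ᴸ u l)) n ≈ sum (λ l → x l * coeff (u l) n)
  coeff-combination x u n = trans (coeff-sum (λ l → constant (x l) *ᴸ u l) n)
    (sum-cong-≋ λ l → constant-* (x l) (u l) n)

  module _ (x : ℕ → ℕ → ∣K∣) where

    -- Comparing coefficients of degree `n`: multiplication by `z` shifts degrees while constants
    -- preserve them, so degree `n - 1` of `u i` is determined by degree `n` of finitely many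
    -- unknowns.
    solves-coeff : ∀ w u → Solves (λ i l → constant (x i l)) w u → ∀ i n →
      coeff (u i) (n ℤ.- + 1) ≈
        coeff (w i) n + sum {suc (i ℕ.+ q)} (λ l → x i (toℕ l) * coeff (u (toℕ l)) n)
    solves-coeff w u s i n = begin
      coeff (u i) (n ℤ.- + 1)    ≈⟨ z-* (u i) n ⟨
      coeff (z *ᴸ u i) n         ≈⟨ s i n ⟩
      _                          ≈⟨ +-congˡ (coeff-combination {suc (i ℕ.+ q)} (λ l → x i (toℕ l)) (λ l → u (toℕ l)) n) ⟩
      coeff (w i) n + sum {suc (i ℕ.+ q)} (λ l → x i (toℕ l) * coeff (u (toℕ l)) n)  ∎

    solves-unique : ∀ w u v → (∀ i → bound (u i) ≤ 0) → (∀ i → bound (v i) ≤ 0) →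
      Solves (λ i l → constant (x i l)) w u → Solves (λ i l → constant (x i l)) w v →
      ∀ i → u i ≈ᴸ v i
    solves-unique w u v u≤0 v≤0 su sv i =
      -- Starting at degree 1, one above the bound 0, makes index 0 a base case in which both sides
      -- vanish.
      expand⇒≈ (u i) (v i) 1 (ℕ.m≤n⇒m≤1+n (u≤0 i)) (ℕ.m≤n⇒m≤1+n (v≤0 i)) λ e → agree e i
      where
      -- The row is quantified inside the induction on `e`, since the recurrence for row `i`
      -- involves other rows one degree higher.
      agree : ∀ e i → expand (u i) 1 e ≈ expand (v i) 1 e
      agree zero    i = trans (expand-top (u i) (u≤0 i)) (sym (expand-top (v i) (v≤0 i)))
      agree (suc e) i = begin
        expand (u i) 1 (suc e)            ≈⟨ coeff-cong (u i) 1-e-1 ⟨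
        coeff (u i) (+ 1 ℤ.- + e ℤ.- + 1)  ≈⟨ solves-coeff w u su i (+ 1 ℤ.- + e) ⟩
        coeff (w i) _ + sum {suc (i ℕ.+ q)} (λ l → x i (toℕ l) * expand (u (toℕ l)) 1 e)
          ≈⟨ +-congˡ (sum-cong-≋ {suc (i ℕ.+ q)} λ l → *-congˡ {x i (toℕ l)} (agree e (toℕ l))) ⟩
        coeff (w i) _ + sum {suc (i ℕ.+ q)} (λ l → x i (toℕ l) * expand (v (toℕ l)) 1 e)
          ≈⟨ solves-coeff w v sv i (+ 1 ℤ.- + e) ⟨
        coeff (v i) (+ 1 ℤ.- + e ℤ.- + 1)  ≈⟨ coeff-cong (v i) 1-e-1 ⟩
        expand (v i) 1 (suc e)            ∎
        where
        1-e-1 : + 1 ℤ.- + e ℤ.- + 1 ≡ + 1 ℤ.- + suc e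
        1-e-1 = ≡.trans (ℤ.+-assoc (+ 1) (ℤ.- + e) (ℤ.- + 1)) (≡.cong (λ i → + 1 ℤ.+ i)
          (≡.trans (≡.sym (ℤ.neg-distrib-+ (+ e) (+ 1))) (≡.cong (λ n → ℤ.- + n) (ℕ.+-comm e 1))))

-- The banded matrices and the continued fraction.

module BandedResolvent {c ℓ₁ ℓ₂} (K : HeytingField c ℓ₁ ℓ₂) (p-1 q-1 : ℕ)
                       (a : ℤ → ℤ → HeytingField.Carrier K) where
  open HeytingCommutativeRing (HeytingField.heytingCommutativeRing K) using (commutativeRing)
  open CommutativeRing commutativeRing hiding (zero) renaming (Carrier to ∣K∣)
  open RingProperties ring using (-0#≈0#)
  open SemiringSum semiring using (sum)
  open Identity commutativeRing using (sum-0)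
  open ContinuedFraction K p-1 q-1 a
  open LaurentProperties K
  open LaurentSystem K q
  private
    module 𝕃 = CommutativeRing laurentCommutativeRing
  open Identity laurentCommutativeRing using (δ)
  open RowFiniteSystem laurentCommutativeRing z q
  open BorderedMatrix laurentCommutativeRing q-1 p-1

  H-band : ∀ k i j → let d = + j ℤ.- + i in ℤ.- + p ℤ.≤ d → d ℤ.≤ + q →
    H k i j ≡ a d (+ (k ℕ.+ (i ℕ.⊓ j)))
  H-band k i j -p≤d d≤q
    rewrite dec-true ((ℤ.- + p ℤ.≤? (+ j ℤ.- + i)) ×-dec ((+ j ℤ.- + i) ℤ.≤? + q)) (-p≤d , d≤q) = ≡.refl

  H-corner : ∀ k → H k 0 0 ≡ a (+ 0) (+ k)
  H-corner k = ≡.trans (H-band k 0 0 ℤ.-≤+ (ℤ.+≤+ ℕ.z≤n)) (≡.cong (λ n → a (+ 0) (+ n)) (ℕ.+-identityʳ k))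

  H-row : ∀ k (j : Fin q) → H k 0 (suc (toℕ j)) ≡ a (+ suc (toℕ j)) (+ k)
  H-row k j = ≡.trans
    (H-band k 0 (suc (toℕ j)) ℤ.-≤+ (≡.subst (ℤ._≤ + q) (≡.sym (ℤ.+-identityʳ (+ suc (toℕ j)))) (ℤ.+≤+ (toℕ<n j))))
    (≡.cong₂ (λ d n → a d (+ n)) (ℤ.+-identityʳ (+ suc (toℕ j))) (ℕ.+-identityʳ k))

  H-col : ∀ k (i : Fin p) → H k (suc (toℕ i)) 0 ≡ a -[1+ toℕ i ] (+ k)
  H-col k i = ≡.trans
    (H-band k (suc (toℕ i)) 0 (ℤ.-≤- (toℕ≤pred[n] i)) ℤ.-≤+)
    (≡.cong (λ n → a -[1+ toℕ i ] (+ n)) (ℕ.+-identityʳ k))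

  H-below-band : ∀ k i → p ≤ i → H k (suc i) 0 ≡ 0#
  H-below-band k i p≤i
    rewrite dec-false ((ℤ.- + p ℤ.≤? -[1+ i ]) ×-dec (-[1+ i ] ℤ.≤? + q))
      (λ where (ℤ.-≤- i≤p-1 , _) → ℕ.<⇒≱ p≤i i≤p-1) = ≡.refl

  -- Entries depend only on `j - i` and `k + min(i, j)`. Raising both indices fixes the former and
  -- increases the latter by one, just as raising `k` does.
  H-suc : ∀ k i j → H k (suc i) (suc j) ≡ H (suc k) i j
  H-suc k i j = ≡.cong₂ (λ d n →
      if does ((ℤ.- + p ℤ.≤? d) ×-dec (d ℤ.≤? + q)) then a d (+ n) else 0#)
    (+1-+1 j i) (ℕ.+-suc k (i ℕ.⊓ j))

  -- Coefficientwise this is the recursion defining the powers of `H k`, the zeroth power accounting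
  -- for the Kronecker delta.
  φ-resolvent : ∀ k → IsResolvent (λ i j → constant (H k i j)) (φ k)
  φ-resolvent k j i n = trans (z-* (φ k i j) n) (trans (shifted n)
    (+-congˡ (sym (coeff-combination {suc (i ℕ.+ q)} (λ l → H k i (toℕ l)) (λ l → φ k (toℕ l) j) n))))
    where
    δ-coeff : ∀ n → coeff (δ i j) n ≈ coeff (constant (if does (i ℕ.≟ j) then 1# else 0#)) n
    δ-coeff n with does (i ℕ.≟ j)
    ... | true  = refl
    ... | false = refl

    combination : ℤ → ∣K∣
    combination n = sum {suc (i ℕ.+ q)} λ l → H k i (toℕ l) * coeff (φ k (toℕ l) j) n

    combination-+ : ∀ n → combination (+ n) ≈ 0#
    combination-+ n = sum-0 {suc (i ℕ.+ q)} _ λ l → zeroʳ (H k i (toℕ l))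

    shifted : ∀ n → coeff (φ k i j) (n ℤ.- + 1) ≈ coeff (δ i j) n + combination n
    -- Degree 0 reads the coefficient of degree -1, which is the zeroth power of the matrix; the
    -- combination has no terms there.
    shifted (+ zero)  = sym (trans (+-cong (δ-coeff (+ 0)) (combination-+ 0)) (+-identityʳ _))
    shifted (+ suc n) = sym (trans (+-cong (δ-coeff (+ suc n)) (combination-+ (suc n))) (+-identityʳ _))
    -- Here the coefficient read is entry `(i , j)` of power `suc n`, whose defining sum is the
    -- combination.
    shifted -[1+ n ]  = trans (coeff-cong (φ k i j) (≡.cong (λ m → -[1+ suc m ]) (ℕ.+-identityʳ n)))
      (sym (trans (+-congʳ (δ-coeff -[1+ n ])) (+-identityˡ _)))

  constant-cong : ∀ {x y} → x ≡ y → constant x 𝕃.≈ constant y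
  constant-cong x≡y = 𝕃.reflexive (≡.cong constant x≡y)

  φ-resolvent-suc : ∀ k → IsResolvent (λ i j → constant (H k (suc i) (suc j))) (φ (suc k))
  φ-resolvent-suc k j = solves-congʰ
    (λ i l → constant (H (suc k) i l)) (λ i l → constant (H k (suc i) (suc l)))
    (λ i → δ i j) (λ i → φ (suc k) i j)
    (λ i l → constant-cong (≡.sym (H-suc k i l))) (φ-resolvent (suc k) j)

  constant-neg : ∀ x → constant (- x) ≈ᴸ -ᴸ constant x
  constant-neg x (+ zero)  = refl
  constant-neg x (+ suc _) = sym -0#≈0#
  constant-neg x -[1+ _ ]  = sym -0#≈0#

  α⁺-border : ∀ k → IdentityUpToLastRow (α⁺ k) (λ j → -ᴸ constant (H k 0 (suc (toℕ j))))
  α⁺-border k = (λ i j → 𝕃.reflexive (inner i j)) , last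
    where
    inner : ∀ i j → α⁺ k (inject₁ i) j ≡ 1ᴹ (inject₁ i) j
    inner i j rewrite view-inject₁ i = ≡.refl

    last : ∀ j → α⁺ k (fromℕ q-1) j ≈ᴸ -ᴸ constant (H k 0 (suc (toℕ j)))
    last j rewrite view-fromℕ q-1 | H-row k j = constant-neg (a (+ suc (toℕ j)) (+ k))

  α⁻-border : ∀ k → IdentityUpToLastColumn (α⁻ k) (λ i → constant (H k (suc (toℕ i)) 0))
  α⁻-border k = (λ i j → 𝕃.reflexive (inner i j)) , λ i → 𝕃.reflexive (last i)
    where
    inner : ∀ i j → α⁻ k i (inject₁ j) ≡ 1ᴹ i (inject₁ j)
    inner i j rewrite view-inject₁ j = ≡.refl

    last : ∀ i → α⁻ k i (fromℕ p-1) ≡ constant (H k (suc (toℕ i)) 0)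
    last i rewrite view-fromℕ p-1 | H-col k i = ≡.refl

  α-inject₁ˡ : ∀ k i j → α k (inject₁ i) j ≡ constant 0#
  α-inject₁ˡ k i j rewrite view-inject₁ i = ≡.refl

  α-inject₁ʳ : ∀ k i j → α k i (inject₁ j) ≡ constant 0#
  α-inject₁ʳ k i j rewrite view-inject₁ j with view i
  ... | ‵fromℕ     = ≡.refl
  ... | ‵inject₁ _ = ≡.refl

  α-corner : ∀ k → α k (fromℕ q-1) (fromℕ p-1) ≡ z +ᴸ -ᴸ constant (H k 0 0)
  α-corner k rewrite view-fromℕ q-1 | view-fromℕ p-1 | H-corner k = ≡.refl

  F≈τF : ∀ k → τ k F[ k ] F[ suc k ]
  F≈τF k = F≈𝟏/ (α k) (α⁺ k) (α⁻ k)
      (λ i j → 𝕃.reflexive (α-inject₁ˡ k i j))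
      (λ i j → 𝕃.reflexive (α-inject₁ʳ k i j))
      (𝕃.reflexive (α-corner k))
      (α⁺-border k) (α⁻-border k)
    where
    open SchurComplement laurentCommutativeRing z p-1 q-1 (λ i j → constant (H k i j)) (φ k) (φ (suc k))
      using (module Entries)
    open Entries
      -- Regularity is bound 0: sums take the maximum of bounds, products add them, and constants
      -- and resolvent entries have bound 0.
      (λ f → bound f ≤ 0)
      ℕ.z≤n
      (λ f≤0 g≤0 → ℕ.⊔-lub f≤0 g≤0)
      (λ f≤0 g≤0 → ℕ.+-mono-≤ f≤0 g≤0)
      (λ i → ℕ.z≤n)
      (λ i j → ℕ.z≤n)
      (λ i j → ℕ.z≤n)
      (λ {w} {u} {v} → solves-unique (λ i j → H k (suc i) (suc j)) w u v)
      (λ i p≤i → constant-cong (H-below-band k i p≤i))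
      (φ-resolvent k)
      (φ-resolvent-suc k)
      using (F≈𝟏/)

  F≈τ∘F : ∀ k → τ∘ k F F[ k ]
  F≈τ∘F zero    = lift λ i j n → refl
  -- The resolvent matrix of the `k`-th truncation is the intermediate value between the first `k`
  -- maps and the new innermost one.
  F≈τ∘F (suc k) = F[ k ] , F≈τ∘F k , F≈τF k

theorem6p2 : ∀ {c ℓ₁ ℓ₂} (K : HeytingField c ℓ₁ ℓ₂) (p-1 q-1 : ℕ)
    (a : ℤ → ℤ → HeytingField.Carrier K) →
    let open ContinuedFraction K p-1 q-1 a in
    ∀ (k : ℕ) → 1 ≤ k → τ∘ k F F[ k ]
theorem6p2 K p-1 q-1 a k _ = BandedResolvent.F≈τ∘F K p-1 q-1 a k
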